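{- Let $k$ be a finite field, $r\in k$, $x \in F_k$ and $\beta \in k$. (i) If $\alpha \in k$ and $\alpha \ne r$, then $\alpha\beta x \sim_r \gamma x$, where \[ \gamma = \frac{r^2 - (\alpha - \beta)r + 1 - \alpha \beta}{r-\alpha}\in k. \] (ii) $r\beta x \in \mathcal{A}_r$ if and only if $x \in \mathcal{A}_0$.
   Context: $F_k$ is the free monoid of all finite words with letters in $k$ (identity: the empty word $\varepsilon$); $\alpha\beta x$, $r\beta x$ and $\gamma x$ denote concatenations of letters with the word $x$ (not products in $k$). $\pi : F_k \to \mathrm{SL}_2(k)$ is the monoid homomorphism with $\pi(\alpha) = \begin{bmatrix} 0 & 1 \\ -1 & \alpha \end{bmatrix}$ for each letter $\alpha \in k$, so $\pi(\alpha_1\cdots\alpha_l)=\pi(\alpha_1)\cdots\pi(\alpha_l)$ and $\pi(\varepsilon)$ is the identity matrix. Let $\mathbb{P}^1(k)$ be the set of equivalence classes of $k^2\smallsetminus\{0\}$ (column vectors) under scaling by elements of $k^\times$; $\mathrm{SL}_2(k)$ acts on it by left multiplication. For $r\in k$, $\mathcal{A}_r = \left\{w \in F_k : \pi(w)\begin{bmatrix} 0 \\ 1 \end{bmatrix} = \begin{bmatrix} 1 \\ r \end{bmatrix} \text{ in } \mathbb{P}^1(k)\right\}$ and $\mathcal{C}_r = F_k\smallsetminus\mathcal{A}_r$. The relation $\sim_r$ is the equivalence relation on $F_k$ induced by the partition $F_k=\mathcal{A}_r\sqcup\mathcal{C}_r$: $w\sim_r w'$ if and only if $w,w'$ are both in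 $\mathcal{A}_r$ or both in $\mathcal{C}_r$. -}

module Defs where

open import Algebra.Bundles using (CommutativeRing)
open import Algebra.Definitions using (Invertible)
open import Data.Fin.Base using (Fin)
open import Data.List.Base using (List; []; _∷_)
open import Data.Nat.Base using (ℕ)
open import Data.Product.Base using (Σ-syntax; ∃-syntax; _×_; _,_; proj₁; proj₂)
open import Data.Sum.Base using (_⊎_)
open import Function.Base using (_∘_)
open import Function.Bundles using (Inverse)
open import Level using (_⊔_; suc)
open import Relation.Binary.Bundles using (Setoid)
open import Relation.Binary.Core using (Rel)
import Relation.Binary.PropositionalEquality.Properties as ≡
open import Relation.Nullary.Negation using (¬_)
open import Relation.Unary using (Pred; _∈_; ∁)

-- The field axioms use x ≉ 0# rather than an apartness as in HeytingField:
-- `finite` makes _≈_ decidable, so the two notions of field agree here.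
record FiniteField c ℓ : Set (suc (c ⊔ ℓ)) where
  field
    commutativeRing : CommutativeRing c ℓ

  open CommutativeRing commutativeRing public

  field
    1≉0        : 1# ≉ 0#
    invertible : ∀ {x} → x ≉ 0# → Invertible _≈_ 1# _*_ x
    size       : ℕ
    finite     : Inverse setoid (≡.setoid (Fin size))

module Words {c ℓ} (K : FiniteField c ℓ) where

  open FiniteField K
  open import Algebra.Properties.Group +-group
    using (x∙y⁻¹≈ε⇒x≈y)
  open import Algebra.Solver.Ring.NaturalCoefficients.Default commutativeSemiring
    using (solve; _:=_; _:+_; _:*_; con)
  open import Relation.Binary.Reasoning.Setoid setoid

  infixl 7 _/_⟨_⟩

  _/_⟨_⟩ : (x y : Carrier) → y ≉ 0# → Carrier
  x / y ⟨ y≉0 ⟩ = x * proj₁ (invertible y≉0)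

  x≉y⇒y-x≉0 : ∀ {x y} → x ≉ y → y - x ≉ 0#
  x≉y⇒y-x≉0 x≉y = x≉y ∘ sym ∘ x∙y⁻¹≈ε⇒x≈y _ _

  private
    x-y≈1⇒x≈1+y : ∀ {x y} → x - y ≈ 1# → x ≈ 1# + y
    x-y≈1⇒x≈1+y {x} {y} eq = begin
      x                ≈⟨ +-identityʳ x ⟨
      x + 0#           ≈⟨ +-congˡ (-‿inverseˡ y) ⟨
      x + (- y + y)    ≈⟨ +-assoc x (- y) y ⟨
      (x - y) + y      ≈⟨ +-congʳ eq ⟩
      1# + y           ∎

    x≈1+y⇒x-y≈1 : ∀ {x y} → x ≈ 1# + y → x - y ≈ 1#
    x≈1+y⇒x-y≈1 {x} {y} eq = begin
      x - y            ≈⟨ +-congʳ eq ⟩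
      (1# + y) - y     ≈⟨ +-assoc 1# y (- y) ⟩
      1# + (y - y)     ≈⟨ +-congˡ (-‿inverseʳ y) ⟩
      1# + 0#          ≈⟨ +-identityʳ 1# ⟩
      1#               ∎

  -- mat a b c d has rows (a , b) and (c , d).
  record Matrix : Set c where
    constructor mat
    field
      m₀₀ m₀₁ m₁₀ m₁₁ : Carrier

  det : Matrix → Carrier
  det (mat a b c d) = a * d - b * c

  infixl 7 _⊗_

  _⊗_ : Matrix → Matrix → Matrix
  mat a b c d ⊗ mat e f g h =
    mat (a * e + b * g) (a * f + b * h) (c * e + d * g) (c * f + d * h)

  SL₂ : Set (c ⊔ ℓ)
  SL₂ = Σ[ M ∈ Matrix ] det M ≈ 1#

  det-⊗ : ∀ M N → det M ≈ 1# → det N ≈ 1# → det (M ⊗ N) ≈ 1#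
  det-⊗ (mat a b c d) (mat e f g h) detM detN = x≈1+y⇒x-y≈1 (begin
    (a * e + b * g) * (c * f + d * h)
      ≈⟨ solve 8 (λ a b c d e f g h →
           (a :* e :+ b :* g) :* (c :* f :+ d :* h) :=
           (a :* c :* e :* f :+ b :* d :* g :* h) :+
           ((a :* d) :* (e :* h) :+ (b :* c) :* (f :* g))) refl a b c d e f g h ⟩
    p + ((a * d) * (e * h) + s * t)
      ≈⟨ +-congˡ (+-congʳ (*-cong ad≈1+s eh≈1+t)) ⟩
    p + ((1# + s) * (1# + t) + s * t)
      ≈⟨ solve 3 (λ p s t →
           p :+ ((con 1 :+ s) :* (con 1 :+ t) :+ s :* t) :=
           con 1 :+ (p :+ ((con 1 :+ s) :* t :+ s :* (con 1 :+ t)))) refl p s t ⟩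
    1# + (p + ((1# + s) * t + s * (1# + t)))
      ≈⟨ +-congˡ (+-congˡ (+-cong (*-congʳ ad≈1+s) (*-congˡ eh≈1+t))) ⟨
    1# + (p + ((a * d) * t + s * (e * h)))
      ≈⟨ +-congˡ (solve 8 (λ a b c d e f g h →
           (a :* c :* e :* f :+ b :* d :* g :* h) :+
           ((a :* d) :* (f :* g) :+ (b :* c) :* (e :* h)) :=
           (a :* f :+ b :* h) :* (c :* e :+ d :* g)) refl a b c d e f g h) ⟩
    1# + (a * f + b * h) * (c * e + d * g) ∎)
    where
    p s t : Carrier
    p = a * c * e * f + b * d * g * h
    s = b * c
    t = f * g
    ad≈1+s : a * d ≈ 1# + s
    ad≈1+s = x-y≈1⇒x≈1+y detM
    eh≈1+t : e * h ≈ 1# + t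
    eh≈1+t = x-y≈1⇒x≈1+y detN

  infixl 7 _∙_

  _∙_ : SL₂ → SL₂ → SL₂
  (M , detM) ∙ (N , detN) = M ⊗ N , det-⊗ M N detM detN

  I₂ : SL₂
  I₂ = mat 1# 0# 0# 1# , x≈1+y⇒x-y≈1 (begin
    1# * 1#        ≈⟨ *-identityˡ 1# ⟩
    1#             ≈⟨ +-identityʳ 1# ⟨
    1# + 0#        ≈⟨ +-congˡ (zeroˡ 0#) ⟨
    1# + 0# * 0#   ∎)

  F : Set c
  F = List Carrier

  π-letter : Carrier → SL₂
  π-letter α = mat 0# 1# (- 1#) α , x≈1+y⇒x-y≈1 (begin
    0# * α            ≈⟨ zeroˡ α ⟩
    0#                ≈⟨ -‿inverseʳ 1# ⟨
    1# - 1#           ≈⟨ +-congˡ (*-identityˡ (- 1#)) ⟨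
    1# + 1# * (- 1#)  ∎)

  π : F → SL₂
  π []      = I₂
  π (α ∷ w) = π-letter α ∙ π w

  record NonzeroVector : Set (c ⊔ ℓ) where
    constructor vec
    field
      v₀ v₁   : Carrier
      nonzero : ¬ (v₀ ≈ 0# × v₁ ≈ 0#)

  _≈ₚ_ : Rel NonzeroVector (c ⊔ ℓ)
  vec x y _ ≈ₚ vec x′ y′ _ =
    ∃[ μ ] μ ≉ 0# × x ≈ μ * x′ × y ≈ μ * y′

  private
    x*y≈1⇒x≉0 : ∀ {x y} → x * y ≈ 1# → x ≉ 0#
    x*y≈1⇒x≉0 {x} {y} xy≈1 x≈0 =
      1≉0 (trans (sym xy≈1) (trans (*-congʳ x≈0) (zeroˡ y)))

    cancel : ∀ {μ ν x y} → ν * μ ≈ 1# → x ≈ μ * y → y ≈ ν * x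
    cancel {μ} {ν} {x} {y} νμ≈1 x≈μy = begin
      y             ≈⟨ *-identityˡ y ⟨
      1# * y        ≈⟨ *-congʳ νμ≈1 ⟨
      (ν * μ) * y   ≈⟨ *-assoc ν μ y ⟩
      ν * (μ * y)   ≈⟨ *-congˡ x≈μy ⟨
      ν * x         ∎

    compose : ∀ {μ ν x y z} → x ≈ μ * y → y ≈ ν * z → x ≈ (μ * ν) * z
    compose {μ} {ν} {z = z} x≈μy y≈νz =
      trans x≈μy (trans (*-congˡ y≈νz) (sym (*-assoc μ ν z)))

    μν≉0 : ∀ {μ ν} → μ ≉ 0# → ν ≉ 0# → μ * ν ≉ 0#
    μν≉0 {μ} {ν} μ≉0 ν≉0 μν≈0 with invertible μ≉0
    ... | μ⁻¹ , μ⁻¹μ≈1 , _ =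
      ν≉0 (trans (cancel μ⁻¹μ≈1 (sym μν≈0)) (zeroʳ μ⁻¹))

  ℙ¹ : Setoid (c ⊔ ℓ) (c ⊔ ℓ)
  ℙ¹ = record
    { Carrier       = NonzeroVector
    ; _≈_           = _≈ₚ_
    ; isEquivalence = record
      { refl  = 1# , 1≉0 , sym (*-identityˡ _) , sym (*-identityˡ _)
      ; sym   = λ { (μ , μ≉0 , x≈ , y≈) →
          let (μ⁻¹ , μ⁻¹μ≈1 , _) = invertible μ≉0
          in μ⁻¹ , x*y≈1⇒x≉0 μ⁻¹μ≈1 , cancel μ⁻¹μ≈1 x≈ , cancel μ⁻¹μ≈1 y≈ }
      ; trans = λ { (μ , μ≉0 , x≈ , y≈) (ν , ν≉0 , x′≈ , y′≈) →
          μ * ν , μν≉0 μ≉0 ν≉0 , compose x≈ x′≈ , compose y≈ y′≈ }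
      }
    }

  private
    Mv≈0⇒v≈0 : ∀ {a b c d x y} → det (mat a b c d) ≈ 1# →
               a * x + b * y ≈ 0# × c * x + d * y ≈ 0# → x ≈ 0# × y ≈ 0#
    Mv≈0⇒v≈0 {a} {b} {c} {d} {x} {y} detM (p≈0 , q≈0) =
      vanish
        (solve 5 (λ b c d x y → (con 1 :+ b :* c) :* x :+ d :* (b :* y) :=
                                x :+ b :* (c :* x :+ d :* y)) refl b c d x y)
        (trans (+-congʳ (*-congʳ (sym ad≈1+bc)))
          (solve 5 (λ a b d x y → (a :* d) :* x :+ d :* (b :* y) :=
                                  d :* (a :* x :+ b :* y)) refl a b d x y))
        q≈0 p≈0 ,
      vanish
        (solve 5 (λ a b c x y → (con 1 :+ b :* c) :* y :+ a :* (c :* x) :=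
                                y :+ c :* (a :* x :+ b :* y)) refl a b c x y)
        (trans (+-congʳ (*-congʳ (sym ad≈1+bc)))
          (solve 5 (λ a c d x y → (a :* d) :* y :+ a :* (c :* x) :=
                                  a :* (c :* x :+ d :* y)) refl a c d x y))
        p≈0 q≈0
      where
      ad≈1+bc : a * d ≈ 1# + b * c
      ad≈1+bc = x-y≈1⇒x≈1+y detM
      vanish : ∀ {z w e f g h} → w ≈ z + e * f → w ≈ g * h →
               f ≈ 0# → h ≈ 0# → z ≈ 0#
      vanish {z} {w} {e} {f} {g} {h} w≈ w≈′ f≈0 h≈0 = begin
        z            ≈⟨ +-identityʳ z ⟨
        z + 0#       ≈⟨ +-congˡ (zeroʳ e) ⟨
        z + e * 0#   ≈⟨ +-congˡ (*-congˡ f≈0) ⟨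
        z + e * f    ≈⟨ w≈ ⟨
        w            ≈⟨ w≈′ ⟩
        g * h        ≈⟨ *-congˡ h≈0 ⟩
        g * 0#       ≈⟨ zeroʳ g ⟩
        0#           ∎

  infixr 7 _·_

  _·_ : SL₂ → NonzeroVector → NonzeroVector
  (mat a b c d , detM) · vec x y v≉0 =
    vec (a * x + b * y) (c * x + d * y) (v≉0 ∘ Mv≈0⇒v≈0 detM)

  ·-cong : ∀ M {v v′} → v ≈ₚ v′ → (M · v) ≈ₚ (M · v′)
  ·-cong (mat a b c d , _) {vec x y _} {vec x′ y′ _} (μ , μ≉0 , x≈ , y≈) =
    μ , μ≉0 , linear a b , linear c d
    where
    linear : ∀ e f → e * x + f * y ≈ μ * (e * x′ + f * y′)
    linear e f = trans (+-cong (*-congˡ x≈) (*-congˡ y≈))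
      (solve 5 (λ e f μ x′ y′ → e :* (μ :* x′) :+ f :* (μ :* y′) :=
                                μ :* (e :* x′ :+ f :* y′)) refl e f μ x′ y′)

  [0∶1] : NonzeroVector
  [0∶1] = vec 0# 1# (1≉0 ∘ proj₂)

  [1∶_] : Carrier → NonzeroVector
  [1∶ r ] = vec 1# r (1≉0 ∘ proj₁)

  𝒜 : Carrier → Pred F (c ⊔ ℓ)
  𝒜 r w = Setoid._≈_ ℙ¹ (π w · [0∶1]) [1∶ r ]

  𝒞 : Carrier → Pred F (c ⊔ ℓ)
  𝒞 r = ∁ (𝒜 r)

  infix 4 _∼[_]_

  _∼[_]_ : F → Carrier → F → Set (c ⊔ ℓ)
  w ∼[ r ] w′ = (w ∈ 𝒜 r × w′ ∈ 𝒜 r) ⊎ (w ∈ 𝒞 r × w′ ∈ 𝒞 r)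

{-# OPTIONS --safe #-}
module Submission where

open import Defs using (FiniteField; module Words)
open import Data.Fin.Properties using (_≟_)
open import Data.List.Base using (_∷_)
open import Data.Product.Base using (_×_; _,_; proj₁; proj₂)
open import Data.Sum.Base using (inj₁; inj₂)
open import Function.Base using (_∘_)
open import Function.Bundles using (_⇔_; mk⇔; module Equivalence)
open import Function.Construct.Composition renaming (_⇔-∘_ to infixr 9 _⇔∘_)
open import Function.Construct.Symmetry using (⇔-sym)
open import Function.Properties.Inverse using (Inverse⇒Injection)
open import Relation.Binary.Definitions using (Decidable)
open import Relation.Nullary.Decidable using (Dec; yes; no; map; via-injection)
open import Relation.Unary using (_∈_)

-- If (p , q) is the column π(x)(0 , 1)ᵗ, then α ∷ x ∈ 𝒜 r says (α − r) q = p.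
-- For α ∷ β ∷ x the column (p , q) becomes (q , X) with X = β q − p, and
--   (r − α) ((γ − r) q − p) = (r − α) X + q
-- is exactly the definition of γ; so for α ≠ r both sides vanish together,
-- while for α = r the condition is q = 0.  Equations are kept free of
-- subtraction so that they are in reach of the semiring solver.
module WordProperties {c ℓ} (K : FiniteField c ℓ) where

  open FiniteField K
  open Words K
  open NonzeroVector using (v₀; v₁)
  open import Algebra.Properties.Group +-group
    using (//-rightDividesˡ; ∙-cancelˡ; ∙-cancelʳ; identityʳ-unique)
  open import Algebra.Solver.Ring.NaturalCoefficients.Default commutativeSemiring
    using (solve; _:=_; _:+_; _:*_; con)
  open import Relation.Binary.Reasoning.Setoid setoid

  _≈?_ : Decidable _≈_
  _≈?_ = via-injection (Inverse⇒Injection finite) _≟_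

  ≉0⇒*-cancelˡ : ∀ {s} → s ≉ 0# → ∀ {x y} → s * x ≈ s * y → x ≈ y
  ≉0⇒*-cancelˡ {s} s≉0 {x} {y} sx≈sy with invertible s≉0
  ... | s⁻¹ , s⁻¹s≈1 , _ = begin
    x              ≈⟨ expand x ⟩
    s⁻¹ * (s * x)  ≈⟨ *-congˡ sx≈sy ⟩
    s⁻¹ * (s * y)  ≈⟨ expand y ⟨
    y              ∎
    where
    expand : ∀ z → z ≈ s⁻¹ * (s * z)
    expand z = begin
      z              ≈⟨ *-identityˡ z ⟨
      1# * z         ≈⟨ *-congʳ s⁻¹s≈1 ⟨
      s⁻¹ * s * z    ≈⟨ *-assoc s⁻¹ s z ⟩
      s⁻¹ * (s * z)  ∎

  */-cancelˡ : ∀ x y (y≉0 : y ≉ 0#) → y * (x / y ⟨ y≉0 ⟩) ≈ x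
  */-cancelˡ x y y≉0 with invertible y≉0
  ... | y⁻¹ , y⁻¹y≈1 , _ = begin
    y * (x * y⁻¹)  ≈⟨ solve 3 (λ x y z → y :* (x :* z) := x :* (z :* y)) refl x y y⁻¹ ⟩
    x * (y⁻¹ * y)  ≈⟨ *-congˡ y⁻¹y≈1 ⟩
    x * 1#         ≈⟨ *-identityʳ x ⟩
    x              ∎

  -- A subtraction-free form of a - c = d - b: if one difference vanishes, so does the other.
  +-balance : ∀ {a b c d} → a + b ≈ c + d → a ≈ c ⇔ b ≈ d
  +-balance {a} {b} {c} {d} eq = mk⇔
    (λ a≈c → ∙-cancelˡ c b d (trans (+-congʳ (sym a≈c)) eq))
    (λ b≈d → ∙-cancelʳ d a c (trans (+-congˡ (sym b≈d)) eq))

  ≈ₚ[1∶]⇔ : ∀ v r → (v ≈ₚ [1∶ r ]) ⇔ v₁ v ≈ r * v₀ v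
  ≈ₚ[1∶]⇔ (vec x y v≉0) r = mk⇔
    (λ (μ , _ , x≈ , y≈) → begin
      y             ≈⟨ y≈ ⟩
      μ * r         ≈⟨ solve 2 (λ μ r → μ :* r := r :* (μ :* con 1)) refl μ r ⟩
      r * (μ * 1#)  ≈⟨ *-congˡ x≈ ⟨
      r * x         ∎)
    (λ y≈rx →
      -- The second coordinate 1 ∶ r normalises the first entry to 1, so the scalar has to be `x`;
      -- were it zero, `y` would vanish too.
      x ,
      (λ x≈0 → v≉0 (x≈0 , trans y≈rx (trans (*-congˡ x≈0) (zeroʳ r)))) ,
      sym (*-identityʳ x) ,
      trans y≈rx (*-comm r x))

  -- The entries of the column (p , q) attached to a word.
  top bottom : F → Carrier
  top    w = v₀ (π w · [0∶1])
  bottom w = v₁ (π w · [0∶1])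

  top-∷ : ∀ α w → top (α ∷ w) ≈ bottom w
  top-∷ α w = solve 4 (λ a b c d →
      (con 0 :* a :+ con 1 :* c) :* con 0 :+ (con 0 :* b :+ con 1 :* d) :* con 1 :=
      c :* con 0 :+ d :* con 1) refl m₀₀ m₀₁ m₁₀ m₁₁
    where open Matrix (proj₁ (π w))

  bottom-∷ : ∀ α w → bottom (α ∷ w) + top w ≈ α * bottom w
  bottom-∷ α w = begin
    bottom (α ∷ w) + top w
      -- The semiring solver sees `- 1#` only as a variable `n`, so a factor `n + 1` is left to
      -- cancel by hand.
      ≈⟨ solve 6 (λ n α a b c d →
           (n :* a :+ α :* c) :* con 0 :+ (n :* b :+ α :* d) :* con 1 :+
           (a :* con 0 :+ b :* con 1) :=
           α :* (c :* con 0 :+ d :* con 1) :+ (n :+ con 1) :* b)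
           refl (- 1#) α m₀₀ m₀₁ m₁₀ m₁₁ ⟩
    α * bottom w + (- 1# + 1#) * m₀₁
      ≈⟨ +-congˡ (*-congʳ (-‿inverseˡ 1#)) ⟩
    α * bottom w + 0# * m₀₁
      ≈⟨ +-congˡ (zeroˡ m₀₁) ⟩
    α * bottom w + 0#
      ≈⟨ +-identityʳ _ ⟩
    α * bottom w ∎
    where open Matrix (proj₁ (π w))

  ∷∈𝒜⇔ : ∀ r α w → (α ∷ w) ∈ 𝒜 r ⇔ α * bottom w ≈ r * bottom w + top w
  ∷∈𝒜⇔ r α w = mk⇔
    (λ bottom≈r*top → begin
      α * bottom w             ≈⟨ bottom-∷ α w ⟨
      bottom (α ∷ w) + top w   ≈⟨ +-congʳ bottom≈r*top ⟩
      r * top (α ∷ w) + top w  ≈⟨ +-congʳ (*-congˡ (top-∷ α w)) ⟩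
      r * bottom w + top w     ∎)
    (λ eq → ∙-cancelʳ (top w) _ _ (begin
      bottom (α ∷ w) + top w   ≈⟨ bottom-∷ α w ⟩
      α * bottom w             ≈⟨ eq ⟩
      r * bottom w + top w     ≈⟨ +-congʳ (*-congˡ (top-∷ α w)) ⟨
      r * top (α ∷ w) + top w  ∎))
    ⇔∘ ≈ₚ[1∶]⇔ (π (α ∷ w) · [0∶1]) r

  -- The top entry for `β ∷ x` is `bottom x`, so `top x` enters only through `bottom (β ∷ x)`.
  ∷∷∈𝒜⇔ : ∀ r α β x → (α ∷ β ∷ x) ∈ 𝒜 r ⇔
          α * bottom (β ∷ x) ≈ r * bottom (β ∷ x) + bottom x
  ∷∷∈𝒜⇔ r α β x = mk⇔
    (λ eq → trans eq (+-congˡ (top-∷ β x)))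
    (λ eq → trans eq (+-congˡ (sym (top-∷ β x))))
    ⇔∘ ∷∈𝒜⇔ r α (β ∷ x)

  ∈𝒜-dec : ∀ r w → Dec (w ∈ 𝒜 r)
  ∈𝒜-dec r w = map (⇔-sym (≈ₚ[1∶]⇔ (π w · [0∶1]) r)) (bottom w ≈? (r * top w))

  -- `_∼[_]_` is a disjunction, so an equivalence alone does not suffice: membership must be
  -- decided, which finiteness of the field allows.
  ⇔⇒∼ : ∀ r w w′ → w ∈ 𝒜 r ⇔ w′ ∈ 𝒜 r → w ∼[ r ] w′
  ⇔⇒∼ r w w′ w⇔w′ with ∈𝒜-dec r w
  ... | yes w∈ = inj₁ (w∈ , Equivalence.to w⇔w′ w∈)
  ... | no  w∉ = inj₂ (w∉ , w∉ ∘ Equivalence.from w⇔w′)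

  numerator-+ : ∀ r α β →
    (r * r - (α - β) * r + 1# - α * β) + (α * r + α * β) ≈ r * r + β * r + 1#
  numerator-+ r α β = begin
    (r * r - δ * r + 1# - α * β) + (α * r + α * β)
      -- Splitting the added `α` as `δ + β` supplies the `δ * r` that cancels `- (δ * r)` and leaves
      -- `β * r`.
      ≈⟨ +-congˡ (+-congʳ (*-congʳ (//-rightDividesˡ β α))) ⟨
    (r * r - δ * r + 1# - α * β) + ((δ + β) * r + α * β)
      ≈⟨ solve 6 (λ r β δ u v m →
           (r :* r :+ u :+ con 1 :+ v) :+ ((δ :+ β) :* r :+ m) :=
           (r :* r :+ β :* r :+ con 1) :+ ((u :+ δ :* r) :+ (v :+ m)))
           refl r β δ (- (δ * r)) (- (α * β)) (α * β) ⟩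
    (r * r + β * r + 1#) + ((- (δ * r) + δ * r) + (- (α * β) + α * β))
      ≈⟨ +-congˡ (+-cong (-‿inverseˡ _) (-‿inverseˡ _)) ⟩
    (r * r + β * r + 1#) + (0# + 0#)
      ≈⟨ +-congˡ (+-identityʳ 0#) ⟩
    (r * r + β * r + 1#) + 0#
      ≈⟨ +-identityʳ _ ⟩
    r * r + β * r + 1# ∎
    where
    δ : Carrier
    δ = α - β

  -- With `s` for r - α, negative terms are moved across so that `+-balance` applies: the first
  -- summands express membership of `γ ∷ x`, up to the factor `s`, and the second that of
  -- `α ∷ β ∷ x`.
  contraction-identity : ∀ {r s α β γ p q X} →
    s + α ≈ r → s * γ + (α * r + α * β) ≈ r * r + β * r + 1# → X + p ≈ β * q →
    s * (γ * q) + α * X ≈ s * (r * q + p) + (r * X + q)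
  contraction-identity {r} {s} {α} {β} {γ} {p} {q} {X} s+α≈r γ-eq X-eq =
    -- This extra term completes `s * γ` to the left side of `γ-eq`.
    ∙-cancelʳ ((α * r + α * β) * q) _ _ (begin
      s * (γ * q) + α * X + (α * r + α * β) * q
        ≈⟨ solve 6 (λ s γ q α X t →
             s :* (γ :* q) :+ α :* X :+ t :* q := (s :* γ :+ t) :* q :+ α :* X)
             refl s γ q α X (α * r + α * β) ⟩
      (s * γ + (α * r + α * β)) * q + α * X
        ≈⟨ +-congʳ (*-congʳ γ-eq) ⟩
      (r * r + β * r + 1#) * q + α * X
        -- Replacing one `r` in each product by `s + α` isolates `s * (β * q)`, where `X-eq` brings
        -- in `p`; the `α` parts reproduce the extra term.
        ≈⟨ +-congʳ (*-congʳ (+-congʳ (+-cong (*-congʳ s+α≈r) (*-congˡ s+α≈r)))) ⟨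
      ((s + α) * r + β * (s + α) + 1#) * q + α * X
        ≈⟨ solve 6 (λ r s α β q X →
             ((s :+ α) :* r :+ β :* (s :+ α) :+ con 1) :* q :+ α :* X :=
             s :* (β :* q) :+ (s :* r :* q :+ α :* X :+ q :+ (α :* r :+ α :* β) :* q))
             refl r s α β q X ⟩
      s * (β * q) + (s * r * q + α * X + q + (α * r + α * β) * q)
        ≈⟨ +-congʳ (*-congˡ X-eq) ⟨
      s * (X + p) + (s * r * q + α * X + q + (α * r + α * β) * q)
        ≈⟨ solve 7 (λ r s α p q X t →
             s :* (X :+ p) :+ (s :* r :* q :+ α :* X :+ q :+ t :* q) :=
             s :* (r :* q :+ p) :+ ((s :+ α) :* X :+ q) :+ t :* q)
             refl r s α p q X (α * r + α * β) ⟩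
      s * (r * q + p) + ((s + α) * X + q) + (α * r + α * β) * q
        ≈⟨ +-congʳ (+-congˡ (+-congʳ (*-congʳ s+α≈r))) ⟩
      s * (r * q + p) + (r * X + q) + (α * r + α * β) * q ∎)

  ∷∷-contract : ∀ r α β x (α≉r : α ≉ r) →
    let γ = (r * r - (α - β) * r + 1# - α * β) / (r - α) ⟨ x≉y⇒y-x≉0 α≉r ⟩
    in (α ∷ β ∷ x) ∈ 𝒜 r ⇔ (γ ∷ x) ∈ 𝒜 r
  ∷∷-contract r α β x α≉r =
    -- The chain reads from the bottom up; α ≠ r makes the factor `r - α` cancellable.
    ⇔-sym (∷∈𝒜⇔ r γ x)
    ⇔∘ mk⇔ (≉0⇒*-cancelˡ r-α≉0) *-congˡ
    ⇔∘ ⇔-sym (+-balance (contraction-identity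
          (//-rightDividesˡ α r)
          (trans (+-congʳ (*/-cancelˡ _ (r - α) r-α≉0)) (numerator-+ r α β))
          (bottom-∷ β x)))
    ⇔∘ ∷∷∈𝒜⇔ r α β x
    where
    r-α≉0 : r - α ≉ 0#
    r-α≉0 = x≉y⇒y-x≉0 α≉r
    γ : Carrier
    γ = (r * r - (α - β) * r + 1# - α * β) / (r - α) ⟨ r-α≉0 ⟩

  r∷∷∈𝒜⇔∈𝒜0 : ∀ r β x → (r ∷ β ∷ x) ∈ 𝒜 r ⇔ x ∈ 𝒜 0#
  r∷∷∈𝒜⇔∈𝒜0 r β x =
    -- A vanishing bottom entry means that the column of `x` represents the point `[1∶ 0# ]`.
    ⇔-sym (≈ₚ[1∶]⇔ (π x · [0∶1]) 0#)
    ⇔∘ mk⇔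
      (λ eq → trans (identityʳ-unique _ _ (sym eq)) (sym (zeroˡ (top x))))
      (λ eq → sym (trans (+-congˡ (trans eq (zeroˡ (top x)))) (+-identityʳ _)))
    ⇔∘ ∷∷∈𝒜⇔ r r β x

theorem3p1 : ∀ {c ℓ} (K : FiniteField c ℓ) →
    let open FiniteField K
        open Words K
    in (r : Carrier) (x : F) (β : Carrier) →
       ((α : Carrier) (α≉r : α ≉ r) →
         let γ = (r * r - (α - β) * r + 1# - α * β) / (r - α) ⟨ x≉y⇒y-x≉0 α≉r ⟩
         in (α ∷ β ∷ x) ∼[ r ] (γ ∷ x))
       ×
       ((r ∷ β ∷ x) ∈ 𝒜 r ⇔ x ∈ 𝒜 0#)
theorem3p1 K r x β =
  (λ α α≉r → ⇔⇒∼ r (α ∷ β ∷ x) (_ ∷ x) (∷∷-contract r α β x α≉r)) , r∷∷∈𝒜⇔∈𝒜0 r β x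
  where open WordProperties K
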